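{- Let $G$ be any Abelian group. There are absolute constants $c,C>0$ such that $\mathcal{P}_1(\{0,1\}^n,G)$ has a $(\delta,q)$-local correction algorithm for every $\delta< c/\log n$ with $q\le C\log n$.
   Context: $\mathcal{P}_1(\{0,1\}^n,G)$ is the set of functions $P(x)=a_0+\sum_{i=1}^n a_ix_i$ with $a_i\in G$, $x\in\{0,1\}^n$. $\delta(f,P)=\Pr_{x\sim\{0,1\}^n}[f(x)\ne P(x)]$. A class $\mathcal{F}$ has a $(\delta,q)$-local correction algorithm if there is a probabilistic algorithm that, given oracle access to any $f$ with $\delta(f,P)\le\delta$ for some $P\in\mathcal{F}$ and any input $a\in\{0,1\}^n$, outputs $P(a)$ with probability at least $3/4$ using at most $q$ queries. -}

module Defs where

open import Level using (Level; _⊔_)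
open import Algebra.Bundles using (AbelianGroup)
open import Data.Bool using (Bool; true; false)
open import Data.Nat as ℕ using (ℕ; zero; suc; _^_)
open import Data.Nat.Logarithm using (⌊log₂_⌋)
open import Data.Integer using (+_)
open import Data.Rational as Q using (ℚ; _/_; 1ℚ)
open import Data.Vec using (Vec; []; _∷_)
open import Data.List using (List; length)
open import Data.List.Relation.Unary.All using (All)
open import Data.List.Relation.Unary.Unique.Propositional using (Unique)
open import Data.Fin using (Fin)
open import Data.Fin.Subset using (Subset; _∈_; ∣_∣)
open import Data.Product using (Σ; _×_)

ℕ→ℚ : ℕ → ℚ
ℕ→ℚ k = (+ k) / 1

Cube : ℕ → Set
Cube n = Vec Bool n

logℚ : ℕ → ℚ
logℚ n = ℕ→ℚ (⌊log₂ n ⌋)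

module _ {a ℓ : Level} (G : AbelianGroup a ℓ) where
  open AbelianGroup G

  bitScale : Bool → Carrier → Carrier
  bitScale true  g = g
  bitScale false g = ε

  linSum : ∀ {n} → Vec Carrier n → Cube n → Carrier
  linSum []       []       = ε
  linSum (c ∷ cs) (x ∷ xs) = bitScale x c ∙ linSum cs xs

  affine : ∀ {n} → Carrier → Vec Carrier n → Cube n → Carrier
  affine a₀ as x = a₀ ∙ linSum as x

  CloseTo : ∀ {n} → (Cube n → Carrier) → (Cube n → Carrier) → ℚ → Set ℓ
  CloseTo {n} f P δ =
    Σ (List (Cube n)) λ xs →
      Unique xs × All (λ x → f x ≈ P x) xs × ((1ℚ Q.- δ) Q.* ℕ→ℚ (2 ^ n) Q.≤ ℕ→ℚ (length xs))

  -- adaptive query strategy with at most q queries, oracle answers in G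
  data QTree (n : ℕ) : ℕ → Set a where
    out : ∀ {q} → Carrier → QTree n q
    ask : ∀ {q} → Cube n → (Carrier → QTree n q) → QTree n (suc q)

  run : ∀ {n q} → QTree n q → (Cube n → Carrier) → Carrier
  run (out g)   f = g
  run (ask x k) f = run (k (f x)) f

  -- a probabilistic algorithm: uniformly random seed r ∈ Fin (suc m),
  -- then, on input point, an adaptive deterministic strategy of ≤ q queries
  record Algorithm (n q : ℕ) : Set a where
    field
      seeds    : ℕ
      strategy : Cube n → Fin (suc seeds) → QTree n q

  SucceedsWP34 : ∀ {n q} → Algorithm n q → (Cube n → Carrier) → Cube n → Carrier → Set ℓ
  SucceedsWP34 {n} A f x v =
    Σ (Subset (suc (Algorithm.seeds A))) λ S →
      (∀ r → r ∈ S → run (Algorithm.strategy A x r) f ≈ v)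
      × (3 ℕ.* suc (Algorithm.seeds A) ℕ.≤ 4 ℕ.* ∣ S ∣)

  HasLocalCorrector : ℕ → ℚ → ℕ → Set (a ⊔ ℓ)
  HasLocalCorrector n δ q =
    Σ (Algorithm n q) λ A →
      ∀ (f : Cube n → Carrier) (a₀ : Carrier) (as : Vec Carrier n) →
        CloseTo f (affine a₀ as) δ →
        ∀ (x : Cube n) → SucceedsWP34 A f x (affine a₀ as x)

{-# OPTIONS --safe #-}
module Submission where

-- On input x, query points z⁰, …, z^{2k} and return the combination of the answers with weights
-- 1, 1, -1, 2, -2, …, 2^{k-1}, -2^{k-1}.  These add up to 1, so the answer is P(x) whenever f = P
-- at all queries and, for every coordinate, the bits (w, u, v) of the shifts zʲ ⊕ x satisfy
-- w + u = v, where u and v are read in binary.  There are 2^{k+1} - 1 solutions: (0, u, u) and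
-- (1, u, u + 1); among them every single bit takes each of its values at most 2^k times.  Choosing
-- a solution uniformly and independently for each coordinate, a fixed query hits a given point
-- with probability at most (2^k / (2^{k+1} - 1))^n, which by Bernoulli's inequality is at most
-- 2 · 2^{-n} once n ≤ 2^k.  Hence a union bound over the 2k + 1 queries, with k = 1 + ⌊log₂ n⌋,
-- bounds the failure probability by 2 (2k + 1) δ ≤ 10 δ log n ≤ 1/4.

open import Defs
open import Level using (Level)
open import Algebra.Bundles using (AbelianGroup)
open import Algebra.Properties.AbelianGroup using (⁻¹-∙-comm; xyx⁻¹≈y)
open import Algebra.Properties.CommutativeSemigroup using (interchange; x∙yz≈y∙xz)
open import Data.Bool using (Bool; true; false; _xor_)
import Data.Bool.Properties as Bool
open import Data.Empty using (⊥-elim)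
open import Data.Fin using (Fin; zero; suc)
open import Data.Fin.Subset using (Subset; inside; outside; _∈_; ∣_∣)
open import Data.Integer as ℤ using (+_)
import Data.Integer.Properties as ℤ
open import Data.List as List using (List; []; _∷_; _++_; map; length; cartesianProductWith)
open import Data.List.Membership.Propositional using () renaming (_∈_ to _∈ˡ_)
open import Data.List.Membership.Propositional.Properties using (∈-map⁺; ∈-++⁺ˡ; ∈-++⁺ʳ; ∈-lookup)
open import Data.List.Properties using (map-++; map-∘; length-map; length-++)
open import Data.List.Relation.Unary.All as All using (All; []; _∷_)
import Data.List.Relation.Unary.All.Properties as All
open import Data.List.Relation.Unary.AllPairs using ([]; _∷_)
open import Data.List.Relation.Unary.Any using (here; there)
open import Data.List.Relation.Unary.Unique.Propositional using (Unique)
open import Data.Nat as ℕ using (ℕ; zero; suc; z≤n; s≤s)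
open import Data.Nat.ListAction using (sum)
open import Data.Nat.ListAction.Properties using (sum-++)
open import Data.Nat.Logarithm using (⌊log₂_⌋; ⌊log₂⌋-mono-≤; ⌊log₂[2^n]⌋≡n)
import Data.Nat.Properties as ℕ
open import Data.Nat.Solver using (module +-*-Solver)
open import Data.Product using (Σ; _×_; _,_; proj₁; proj₂)
import Data.Rational as ℚ
import Data.Rational.Properties as ℚ
open import Data.Rational.Solver using () renaming (module +-*-Solver to ℚ-Solver)
import Data.Rational.Unnormalised as ℚᵘ
import Data.Rational.Unnormalised.Properties as ℚᵘ
open import Data.Sum using (inj₁; inj₂)
open import Data.Vec as Vec using (Vec; []; _∷_)
open import Data.Vec.Properties using (≡-dec; lookup-map; lookup-replicate; lookup-zipWith) renaming (map-∘ to map-∘ᵛ)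
open import Data.Vec.Relation.Unary.All as Vecᴬ using ([]; _∷_)
open import Function using (_∘_)
open import Relation.Binary.PropositionalEquality
open import Relation.Nullary using (¬_; Dec; yes; no)

module _ where
  open import Data.Nat using (_+_; _*_; _^_; _≤_; _<_)

  -- Finite sums, Markov's inequality and the union bound

  ∑ : ∀ {a} {A : Set a} → List A → (A → ℕ) → ℕ
  ∑ xs f = sum (map f xs)

  module _ {a} {A : Set a} where

    ∑-++ : (xs ys : List A) (f : A → ℕ) → ∑ (xs ++ ys) f ≡ ∑ xs f + ∑ ys f
    ∑-++ xs ys f = trans (cong sum (map-++ f xs ys)) (sum-++ (map f xs) (map f ys))

    ∑-map : ∀ {b} {B : Set b} (g : B → A) (xs : List B) (f : A → ℕ) → ∑ (map g xs) f ≡ ∑ xs (f ∘ g)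
    ∑-map g xs f = cong sum (sym (map-∘ xs))

    ∑-mono : (xs : List A) {f g : A → ℕ} → (∀ x → f x ≤ g x) → ∑ xs f ≤ ∑ xs g
    ∑-mono []       f≤g = z≤n
    ∑-mono (x ∷ xs) f≤g = ℕ.+-mono-≤ (f≤g x) (∑-mono xs f≤g)

    ∑-mono-< : {xs : List A} {f g : A → ℕ} → (∀ x → f x ≤ g x) → ∀ {x} → x ∈ˡ xs → f x < g x → ∑ xs f < ∑ xs g
    ∑-mono-< {_ ∷ xs} f≤g (here refl) fx<gx = ℕ.+-mono-<-≤ fx<gx (∑-mono xs f≤g)
    ∑-mono-< {y ∷ xs} f≤g (there x∈)  fx<gx = ℕ.+-mono-≤-< (f≤g y) (∑-mono-< f≤g x∈ fx<gx)

    ∑-cong : (xs : List A) {f g : A → ℕ} → (∀ x → f x ≡ g x) → ∑ xs f ≡ ∑ xs g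
    ∑-cong []       f≡g = refl
    ∑-cong (x ∷ xs) f≡g = cong₂ _+_ (f≡g x) (∑-cong xs f≡g)

    ∑-+ : (xs : List A) (f g : A → ℕ) → ∑ xs (λ x → f x + g x) ≡ ∑ xs f + ∑ xs g
    ∑-+ []       f g = refl
    ∑-+ (x ∷ xs) f g = trans (cong (_+_ (f x + g x)) (∑-+ xs f g))
      (solve 4 (λ a b c d → (a :+ b) :+ (c :+ d) := (a :+ c) :+ (b :+ d)) refl (f x) (g x) (∑ xs f) (∑ xs g))
      where open +-*-Solver

    ∑-*ˡ : (xs : List A) (c : ℕ) (f : A → ℕ) → ∑ xs (λ x → c * f x) ≡ c * ∑ xs f
    ∑-*ˡ []       c f = sym (ℕ.*-zeroʳ c)
    ∑-*ˡ (x ∷ xs) c f = trans (cong (_+_ (c * f x)) (∑-*ˡ xs c f)) (sym (ℕ.*-distribˡ-+ c (f x) (∑ xs f)))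

    ∑-const : (xs : List A) (c : ℕ) → ∑ xs (λ _ → c) ≡ length xs * c
    ∑-const []       c = refl
    ∑-const (x ∷ xs) c = cong (_+_ c) (∑-const xs c)

  module _ {a} {A : Set a} where

    ∑-cartesianProductWith : ∀ {b c} {B : Set b} {C : Set c} (h : A → B → C) (xs : List A) (ys : List B) (f : C → ℕ) →
      ∑ (cartesianProductWith h xs ys) f ≡ ∑ xs (λ x → ∑ ys (λ y → f (h x y)))
    ∑-cartesianProductWith h []       ys f = refl
    ∑-cartesianProductWith h (x ∷ xs) ys f =
      trans (∑-++ (map (h x) ys) _ f) (cong₂ _+_ (∑-map (h x) ys f) (∑-cartesianProductWith h xs ys f))

    -- Markov's inequality at threshold 1: weights are natural numbers, so every index outside `S`
    -- contributes at least 1 to the sum. It turns a bound on the total number of bad queries into a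
    -- set of good seeds.
    zeroSet : (xs : List A) (w : A → ℕ) →
      Σ (Subset (length xs)) λ S → (∀ r → r ∈ S → w (List.lookup xs r) ≡ 0) × (length xs ≤ ∣ S ∣ + ∑ xs w)
    zeroSet [] w = [] , (λ ()) , z≤n
    zeroSet (x ∷ xs) w with w x in wx | zeroSet xs w
    ... | zero  | S , zero-on-S , bound =
      inside ∷ S , (λ { zero Vec.here → wx ; (suc r) (Vec.there r∈) → zero-on-S r r∈ }) , s≤s bound
    ... | suc m | S , zero-on-S , bound =
      outside ∷ S , (λ { (suc r) (Vec.there r∈) → zero-on-S r r∈ }) ,
      (begin
        suc (length xs)             ≤⟨ s≤s bound ⟩
        suc (∣ S ∣ + ∑ xs w)        ≡⟨ ℕ.+-suc ∣ S ∣ _ ⟨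
        ∣ S ∣ + suc (∑ xs w)        ≤⟨ ℕ.+-monoʳ-≤ ∣ S ∣ (s≤s (ℕ.m≤n+m _ m)) ⟩
        ∣ S ∣ + suc (m + ∑ xs w)    ∎)
      where open ℕ.≤-Reasoning

  load : ∀ {a} {A : Set a} {q} → (A → ℕ) → Vec A q → ℕ
  load f X = Vec.sum (Vec.map f X)

  load≡0⇒All : ∀ {a} {A : Set a} {q} (f : A → ℕ) (X : Vec A q) → load f X ≡ 0 → Vecᴬ.All (λ x → f x ≡ 0) X
  load≡0⇒All f []      eq = []
  load≡0⇒All f (x ∷ X) eq = ℕ.m+n≡0⇒m≡0 (f x) eq ∷ load≡0⇒All f X (ℕ.m+n≡0⇒n≡0 (f x) eq)

  -- The union bound: the double sum over seeds and query positions is exchanged by splitting off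
  -- one position at a time, and only the distribution of each single position enters.
  ∑-load≤ : ∀ {a b} {A : Set a} {S : Set b} {q} (L : List S) (X : S → Vec A q) (f : A → ℕ) (K : ℕ) →
    (∀ j → ∑ L (λ s → f (Vec.lookup (X s) j)) ≤ K) → ∑ L (λ s → load f (X s)) ≤ q * K
  ∑-load≤ {q = zero} L X f K h =
    ℕ.≤-reflexive (trans (∑-cong L (λ s → empty (X s))) (trans (∑-const L 0) (ℕ.*-zeroʳ (length L))))
    where
    empty : (V : Vec _ 0) → load f V ≡ 0
    empty [] = refl
  ∑-load≤ {q = suc q} L X f K h = begin
    ∑ L (λ s → load f (X s))                                                ≡⟨ ∑-cong L (λ s → uncons (X s)) ⟩
    ∑ L (λ s → f (Vec.lookup (X s) zero) + load f (Vec.tail (X s)))         ≡⟨ ∑-+ L _ _ ⟩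
    ∑ L (λ s → f (Vec.lookup (X s) zero)) + ∑ L (λ s → load f (Vec.tail (X s)))
      ≤⟨ ℕ.+-mono-≤ (h zero) (∑-load≤ L (Vec.tail ∘ X) f K
           (λ j → ℕ.≤-trans (ℕ.≤-reflexive (∑-cong L (λ s → cong f (lookup-tail (X s) j)))) (h (suc j)))) ⟩
    K + q * K ∎
    where
    open ℕ.≤-Reasoning
    uncons : (V : Vec _ (suc q)) → load f V ≡ f (Vec.lookup V zero) + load f (Vec.tail V)
    uncons (_ ∷ _) = refl
    lookup-tail : (V : Vec _ (suc q)) (j : Fin q) → Vec.lookup (Vec.tail V) j ≡ Vec.lookup V (suc j)
    lookup-tail (_ ∷ _) j = refl

  -- Sums over the cube

  cube : ∀ n → List (Cube n)
  cube zero    = [] ∷ []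
  cube (suc n) = map (false ∷_) (cube n) ++ map (true ∷_) (cube n)

  ∈-cube : ∀ {n} (x : Cube n) → x ∈ˡ cube n
  ∈-cube []          = here refl
  ∈-cube (false ∷ x) = ∈-++⁺ˡ (∈-map⁺ (false ∷_) (∈-cube x))
  ∈-cube (true  ∷ x) = ∈-++⁺ʳ (map (false ∷_) (cube _)) (∈-map⁺ (true ∷_) (∈-cube x))

  ∑-cube-suc : ∀ n (f : Cube (suc n) → ℕ) →
    ∑ (cube (suc n)) f ≡ ∑ (cube n) (f ∘ (false ∷_)) + ∑ (cube n) (f ∘ (true ∷_))
  ∑-cube-suc n f = trans (∑-++ (map (false ∷_) (cube n)) _ f) (cong₂ _+_ (∑-map _ (cube n) f) (∑-map _ (cube n) f))

  ∑-cube-1 : ∀ n → ∑ (cube n) (λ _ → 1) ≡ 2 ^ n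
  ∑-cube-1 zero    = refl
  ∑-cube-1 (suc n) = trans (∑-cube-suc n _)
    (cong₂ _+_ (∑-cube-1 n) (trans (∑-cube-1 n) (sym (ℕ.+-identityʳ (2 ^ n)))))

  infixl 6 _⊕_
  _⊕_ : ∀ {n} → Cube n → Cube n → Cube n
  _⊕_ = Vec.zipWith _xor_

  -- Translation by `a` permutes the cube: a `true` bit swaps the two halves, a `false` bit keeps
  -- them. Hence the input point does not affect the bound on where a query lands.
  ∑-cube-⊕ : ∀ {n} (a : Cube n) (f : Cube n → ℕ) → ∑ (cube n) (λ x → f (x ⊕ a)) ≡ ∑ (cube n) f
  ∑-cube-⊕ [] f = refl
  ∑-cube-⊕ {suc n} (false ∷ a) f = trans (∑-cube-suc n _)
    (trans (cong₂ _+_ (∑-cube-⊕ a (f ∘ (false ∷_))) (∑-cube-⊕ a (f ∘ (true ∷_)))) (sym (∑-cube-suc n f)))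
  ∑-cube-⊕ {suc n} (true ∷ a) f = trans (∑-cube-suc n _)
    (trans (cong₂ _+_ (∑-cube-⊕ a (f ∘ (true ∷_))) (∑-cube-⊕ a (f ∘ (false ∷_))))
      (trans (ℕ.+-comm (∑ (cube n) (f ∘ (true ∷_))) _) (sym (∑-cube-suc n f))))

  -- Counting the points outside the agreement list

  private
    ∈-dec : ∀ {n} (x : Cube n) (xs : List (Cube n)) → Dec (x ∈ˡ xs)
    ∈-dec = _∈?_
      where open import Data.List.Membership.DecPropositional (≡-dec Bool._≟_) using (_∈?_)

  -- Equality in `G` need not be decidable, so disagreement of two functions cannot be tested
  -- directly. Its substitute is the complement of the agreement list, as membership of Boolean
  -- vectors in a list is decidable.
  miss : ∀ {n} → List (Cube n) → Cube n → ℕ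
  miss xs x with ∈-dec x xs
  ... | yes _ = 0
  ... | no _  = 1

  miss≡0⇒∈ : ∀ {n} (xs : List (Cube n)) x → miss xs x ≡ 0 → x ∈ˡ xs
  miss≡0⇒∈ xs x eq with ∈-dec x xs
  ... | yes x∈ = x∈

  miss-∈ : ∀ {n} {xs : List (Cube n)} {x} → x ∈ˡ xs → miss xs x ≡ 0
  miss-∈ {xs = xs} {x} x∈ with ∈-dec x xs
  ... | yes _ = refl
  ... | no x∉ = ⊥-elim (x∉ x∈)

  miss-∉ : ∀ {n} {xs : List (Cube n)} {x} → ¬ x ∈ˡ xs → miss xs x ≡ 1
  miss-∉ {xs = xs} {x} x∉ with ∈-dec x xs
  ... | yes x∈ = ⊥-elim (x∉ x∈)
  ... | no _   = refl

  miss≤1 : ∀ {n} (xs : List (Cube n)) x → miss xs x ≤ 1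
  miss≤1 xs x with ∈-dec x xs
  ... | yes _ = z≤n
  ... | no _  = s≤s z≤n

  miss-∷ : ∀ {n} (x : Cube n) xs y → miss (x ∷ xs) y ≤ miss xs y
  miss-∷ x xs y = by-cases (∈-dec y xs)
    where
    by-cases : Dec (y ∈ˡ xs) → miss (x ∷ xs) y ≤ miss xs y
    by-cases (yes y∈) = ℕ.≤-reflexive (trans (miss-∈ (there y∈)) (sym (miss-∈ y∈)))
    by-cases (no y∉)  = subst (miss (x ∷ xs) y ≤_) (sym (miss-∉ y∉)) (miss≤1 (x ∷ xs) y)

  -- By uniqueness `x` is missed by `xs` but not by `x ∷ xs`, so each entry lowers the number of
  -- missed points by at least one, starting from `2 ^ n`.
  ∑-miss : ∀ {n} {xs : List (Cube n)} → Unique xs → ∑ (cube n) (miss xs) + length xs ≤ 2 ^ n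
  ∑-miss {n} [] = ℕ.≤-reflexive (trans (ℕ.+-identityʳ _)
    (trans (∑-cong (cube n) (λ x → miss-∉ {xs = []} {x} (λ ()))) (∑-cube-1 n)))
  ∑-miss {n} {x ∷ xs} (x≢ ∷ uniq) = begin
    ∑ (cube n) (miss (x ∷ xs)) + suc (length xs)   ≡⟨ ℕ.+-suc _ _ ⟩
    suc (∑ (cube n) (miss (x ∷ xs))) + length xs   ≤⟨ ℕ.+-monoˡ-≤ (length xs) (∑-mono-< (miss-∷ x xs) (∈-cube x) drop) ⟩
    ∑ (cube n) (miss xs) + length xs               ≤⟨ ∑-miss uniq ⟩
    2 ^ n                                          ∎
    where
    open ℕ.≤-Reasoning
    drop : miss (x ∷ xs) x < miss xs x
    drop = subst₂ _<_ (sym (miss-∈ {xs = x ∷ xs} (here refl))) (sym (miss-∉ (λ x∈ → All.lookup x≢ x∈ refl))) (s≤s z≤n)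

  -- Random matrices with prescribed row distribution

  -- Transposition: a seed has one row per coordinate of the cube, and its columns are the shifts of
  -- the individual queries.
  columns : ∀ {n q} → Vec (Vec Bool q) n → Vec (Cube n) q
  columns []      = Vec.replicate _ []
  columns (y ∷ M) = Vec.zipWith _∷_ y (columns M)

  words : ∀ {a} {A : Set a} → List A → ∀ n → List (Vec A n)
  words R zero    = [] ∷ []
  words R (suc n) = cartesianProductWith _∷_ R (words R n)

  length-cartesianProductWith : ∀ {a b c} {A : Set a} {B : Set b} {C : Set c} (h : A → B → C) xs ys →
    length (cartesianProductWith h xs ys) ≡ length xs * length ys
  length-cartesianProductWith h []       ys = refl
  length-cartesianProductWith h (x ∷ xs) ys =
    trans (length-++ (map (h x) ys)) (cong₂ _+_ (length-map (h x) ys) (length-cartesianProductWith h xs ys))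

  length-words : ∀ {a} {A : Set a} (R : List A) n → length (words R n) ≡ length R ^ n
  length-words R zero    = refl
  length-words R (suc n) = trans (length-cartesianProductWith _∷_ R (words R n)) (cong (length R *_) (length-words R n))

  All-words : ∀ {a p} {A : Set a} {P : A → Set p} {R : List A} → All P R → ∀ n → All (Vecᴬ.All P) (words R n)
  All-words ps zero    = [] ∷ []
  All-words {A = A} {R = R} ps (suc n) =
    All.cartesianProductWith⁺ (setoid A) (setoid (Vec A n)) _∷_ R (words R n)
      (λ y∈ M∈ → All.lookup ps y∈ ∷ All.lookup (All-words ps n) M∈)

  tally : ∀ {q} → List (Vec Bool q) → Fin q → (Bool → ℕ) → ℕ
  tally R j h = ∑ R (λ y → h (Vec.lookup y j))

  -- With `h` the indicator of a bit, this says that at most `B` rows have that bit at position `j`.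
  -- Arbitrary `h` is the form that the induction over rows consumes, where `h` is a sum over half
  -- of the cube.
  Spread : ∀ {q} → List (Vec Bool q) → ℕ → Set
  Spread {q} R B = ∀ (j : Fin q) (h : Bool → ℕ) → tally R j h ≤ B * (h false + h true)

  -- The rows are independent, so a fixed point is the `j`-th column of at most `B ^ n` matrices.
  -- Induction splits off the first row: the hypothesis is applied to `f` with its first bit fixed,
  -- then `spread` to the resulting sums over the two half cubes.
  ∑-column≤ : ∀ {q B} {R : List (Vec Bool q)} → Spread R B → ∀ n (f : Cube n → ℕ) j →
    ∑ (words R n) (λ M → f (Vec.lookup (columns M) j)) ≤ B ^ n * ∑ (cube n) f
  ∑-column≤ spread zero f j =
    ℕ.≤-reflexive (trans (cong (λ x → f x + 0) (lookup-replicate j [])) (sym (ℕ.+-identityʳ (f [] + 0))))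
  ∑-column≤ {B = B} {R} spread (suc n) f j = begin
    ∑ (words R (suc n)) (λ M → f (Vec.lookup (columns M) j))
      ≡⟨ ∑-cartesianProductWith _∷_ R (words R n) _ ⟩
    ∑ R (λ y → ∑ (words R n) (λ M → f (Vec.lookup (Vec.zipWith _∷_ y (columns M)) j)))
      ≡⟨ ∑-cong R (λ y → ∑-cong (words R n) (λ M → cong f (lookup-zipWith _∷_ j y (columns M)))) ⟩
    ∑ R (λ y → ∑ (words R n) (λ M → f (Vec.lookup y j ∷ Vec.lookup (columns M) j)))
      ≤⟨ ∑-mono R (λ y → ∑-column≤ spread n (f ∘ (Vec.lookup y j ∷_)) j) ⟩
    ∑ R (λ y → B ^ n * h (Vec.lookup y j))
      ≡⟨ ∑-*ˡ R (B ^ n) _ ⟩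
    B ^ n * tally R j h
      ≤⟨ ℕ.*-monoʳ-≤ (B ^ n) (spread j h) ⟩
    B ^ n * (B * (h false + h true))
      ≡⟨ solve 3 (λ x b s → x :* (b :* s) := (b :* x) :* s) refl (B ^ n) B (h false + h true) ⟩
    B ^ suc n * (h false + h true)
      ≡⟨ cong (B ^ suc n *_) (∑-cube-suc n f) ⟨
    B ^ suc n * ∑ (cube (suc n)) f ∎
    where
    open ℕ.≤-Reasoning
    open +-*-Solver
    h : Bool → ℕ
    h b = ∑ (cube n) (f ∘ (b ∷_))

  queries : ∀ {n q} → Cube n → Vec (Vec Bool q) n → Vec (Cube n) q
  queries x M = Vec.map (_⊕ x) (columns M)

  ∑-load-queries≤ : ∀ {n q B} {R : List (Vec Bool q)} → Spread R B → (x : Cube n) (f : Cube n → ℕ) →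
    ∑ (words R n) (λ M → load f (queries x M)) ≤ q * (B ^ n * ∑ (cube n) f)
  ∑-load-queries≤ {n} {q} {B} {R} spread x f = ∑-load≤ (words R n) (queries x) f _ λ j →
    ℕ.≤-trans (ℕ.≤-reflexive (∑-cong (words R n) (λ M → cong f (lookup-map j (_⊕ x) (columns M)))))
      (ℕ.≤-trans (∑-column≤ {B = B} spread n (λ z → f (z ⊕ x)) j)
        (ℕ.≤-reflexive (cong (B ^ n *_) (∑-cube-⊕ x f))))

  -- The row distribution

  -- A vector in Vec Bool (k * 2) interleaves the binary expansions, least significant bit first,
  -- of two numbers u and v: twins lists the cases v = u, and succs the cases v = u + 1.

  twins : ∀ k → List (Vec Bool (k * 2))
  twins zero    = [] ∷ []
  twins (suc k) = map (λ r → false ∷ false ∷ r) (twins k) ++ map (λ r → true ∷ true ∷ r) (twins k)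

  succs : ∀ k → List (Vec Bool (k * 2))
  succs zero    = []
  succs (suc k) = map (λ r → false ∷ true ∷ r) (twins k) ++ map (λ r → true ∷ false ∷ r) (succs k)

  rows : ∀ k → List (Vec Bool (suc (k * 2)))
  rows k = map (false ∷_) (twins k) ++ map (true ∷_) (succs k)

  private
    length-++-map : ∀ {a b} {A B : Set a} {C : Set b} (g : A → C) (h : B → C) xs ys →
      length (map g xs ++ map h ys) ≡ length xs + length ys
    length-++-map g h xs ys = trans (length-++ (map g xs)) (cong₂ _+_ (length-map g xs) (length-map h ys))

    ∑-++-map : ∀ {a b} {A B : Set a} {C : Set b} (g : A → C) (h : B → C) xs ys f →
      ∑ (map g xs ++ map h ys) f ≡ ∑ xs (f ∘ g) + ∑ ys (f ∘ h)
    ∑-++-map g h xs ys f = trans (∑-++ (map g xs) _ f) (cong₂ _+_ (∑-map g xs f) (∑-map h ys f))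

  length-twins : ∀ k → length (twins k) ≡ 2 ^ k
  length-twins zero    = refl
  length-twins (suc k) = trans (length-++-map _ _ (twins k) (twins k))
    (cong₂ _+_ (length-twins k) (trans (length-twins k) (sym (ℕ.+-identityʳ (2 ^ k)))))

  -- Every `k`-bit `u` has a partner `u + 1` except `2 ^ k - 1`, whose successor overflows.
  length-succs : ∀ k → suc (length (succs k)) ≡ 2 ^ k
  length-succs zero    = refl
  length-succs (suc k) = trans (cong suc (length-++-map _ _ (twins k) (succs k)))
    (trans (sym (ℕ.+-suc _ _))
      (cong₂ _+_ (length-twins k) (trans (length-succs k) (sym (ℕ.+-identityʳ (2 ^ k))))))

  length-rows : ∀ k → suc (length (rows k)) ≡ 2 * 2 ^ k
  length-rows k = trans (cong suc (length-++-map _ _ (twins k) (succs k)))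
    (trans (sym (ℕ.+-suc _ _))
      (cong₂ _+_ (length-twins k) (trans (length-succs k) (sym (ℕ.+-identityʳ (2 ^ k))))))

  private
    length-succs≤ : ∀ k → length (succs k) ≤ 2 ^ k
    length-succs≤ k = ℕ.<⇒≤ (ℕ.≤-reflexive (length-succs k))

    ∑-const-twins : ∀ k c → ∑ (twins k) (λ _ → c) ≤ 2 ^ k * c
    ∑-const-twins k c = ℕ.≤-reflexive (trans (∑-const (twins k) c) (cong (_* c) (length-twins k)))

    ∑-const-succs : ∀ k c → ∑ (succs k) (λ _ → c) ≤ 2 ^ k * c
    ∑-const-succs k c = ℕ.≤-trans (ℕ.≤-reflexive (∑-const (succs k) c)) (ℕ.*-monoˡ-≤ c (length-succs≤ k))

    +-bound : ∀ {t s m n} P → s ≤ P * m → t ≤ P * n → s + t ≤ P * (m + n)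
    +-bound P s≤ t≤ = ℕ.≤-trans (ℕ.+-mono-≤ s≤ t≤) (ℕ.≤-reflexive (sym (ℕ.*-distribˡ-+ P _ _)))

    +-bound-swap : ∀ {t s m n} P → s ≤ P * m → t ≤ P * n → s + t ≤ P * (n + m)
    +-bound-swap {m = m} {n} P s≤ t≤ = ℕ.≤-trans (+-bound P s≤ t≤) (ℕ.≤-reflexive (cong (P *_) (ℕ.+-comm m n)))

    2*-bound : ∀ {s P m} → s ≤ P * m → 2 * s ≤ (2 * P) * m
    2*-bound {P = P} {m} s≤ = ℕ.≤-trans (ℕ.*-monoʳ-≤ 2 s≤) (ℕ.≤-reflexive (sym (ℕ.*-assoc 2 P m)))

    2*-+-bound : ∀ s t P {m} → 2 * s ≤ P * m → 2 * t ≤ P * m → 2 * (s + t) ≤ (2 * P) * m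
    2*-+-bound s t P {m} s≤ t≤ = begin
      2 * (s + t)      ≡⟨ ℕ.*-distribˡ-+ 2 s t ⟩
      2 * s + 2 * t    ≤⟨ ℕ.+-mono-≤ s≤ t≤ ⟩
      P * m + P * m    ≡⟨ solve 2 (λ p m → p :* m :+ p :* m := (con 2 :* p) :* m) refl P m ⟩
      (2 * P) * m      ∎
      where
      open ℕ.≤-Reasoning
      open +-*-Solver

  -- A bit of a uniform `k`-bit number is balanced, with `2 ^ (k - 1)` occurrences of each value;
  -- doubling the left side avoids the subtraction in the exponent.
  twins-half : ∀ k (j : Fin (k * 2)) (h : Bool → ℕ) →
    2 * tally (twins k) j h ≤ 2 ^ k * (h false + h true)
  twins-half (suc k) j h =
    subst (λ s → 2 * s ≤ 2 ^ suc k * (h false + h true)) (sym (∑-++-map _ _ (twins k) (twins k) _)) (go j)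
    where
    go : (j : Fin (suc k * 2)) →
      2 * (∑ (twins k) (λ r → h (Vec.lookup (false ∷ false ∷ r) j)) + ∑ (twins k) (λ r → h (Vec.lookup (true ∷ true ∷ r) j)))
        ≤ 2 ^ suc k * (h false + h true)
    go zero          = 2*-bound {P = 2 ^ k} (+-bound (2 ^ k) (∑-const-twins k (h false)) (∑-const-twins k (h true)))
    go (suc zero)    = 2*-bound {P = 2 ^ k} (+-bound (2 ^ k) (∑-const-twins k (h false)) (∑-const-twins k (h true)))
    go (suc (suc j)) = 2*-+-bound (tally (twins k) j h) (tally (twins k) j h) (2 ^ k)
                         (twins-half k j h) (twins-half k j h)

  -- Here `u` omits only `2 ^ k - 1` and `v` only 0, so no bit value occurs more than `2 ^ (k - 1)`
  -- times. In the recursion the lowest bits tell the two sublists apart, and the higher bits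
  -- combine balanced twins with the induction hypothesis.
  succs-half : ∀ k (j : Fin (k * 2)) (h : Bool → ℕ) →
    2 * tally (succs k) j h ≤ 2 ^ k * (h false + h true)
  succs-half (suc k) j h =
    subst (λ s → 2 * s ≤ 2 ^ suc k * (h false + h true)) (sym (∑-++-map _ _ (twins k) (succs k) _)) (go j)
    where
    go : (j : Fin (suc k * 2)) →
      2 * (∑ (twins k) (λ r → h (Vec.lookup (false ∷ true ∷ r) j)) + ∑ (succs k) (λ r → h (Vec.lookup (true ∷ false ∷ r) j)))
        ≤ 2 ^ suc k * (h false + h true)
    go zero          = 2*-bound {P = 2 ^ k} (+-bound (2 ^ k) (∑-const-twins k (h false)) (∑-const-succs k (h true)))
    go (suc zero)    = 2*-bound {P = 2 ^ k} (+-bound-swap (2 ^ k) (∑-const-twins k (h true)) (∑-const-succs k (h false)))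
    go (suc (suc j)) = 2*-+-bound (tally (twins k) j h) (tally (succs k) j h) (2 ^ k)
                         (twins-half k j h) (succs-half k j h)

  -- The leading bit separates twins from successors, at most `2 ^ k` of each; at any other position
  -- each kind contributes at most `2 ^ (k - 1)` per bit value.
  rows-spread : ∀ k → Spread (rows k) (2 ^ k)
  rows-spread k j h = subst (_≤ 2 ^ k * (h false + h true)) (sym (∑-++-map _ _ (twins k) (succs k) _)) (go j)
    where
    go : (j : Fin (suc (k * 2))) →
      ∑ (twins k) (λ r → h (Vec.lookup (false ∷ r) j)) + ∑ (succs k) (λ r → h (Vec.lookup (true ∷ r) j))
        ≤ 2 ^ k * (h false + h true)
    go zero    = +-bound (2 ^ k) (∑-const-twins k (h false)) (∑-const-succs k (h true))
    go (suc j) = ℕ.*-cancelˡ-≤ 2 (ℕ.≤-trans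
      (2*-+-bound (tally (twins k) j h) (tally (succs k) j h) (2 ^ k) (twins-half k j h) (succs-half k j h))
      (ℕ.≤-reflexive (ℕ.*-assoc 2 (2 ^ k) _)))

  -- Numerical estimates

  -- With `N = suc M` this is `(1 - 1/N)^n ≥ 1 - n/N`, multiplied by `N ^ suc n` and arranged to
  -- avoid subtraction.
  bernoulli : ∀ M n → suc M ^ suc n ≤ M ^ n * suc M + n * suc M ^ n
  bernoulli M zero    = ℕ.≤-reflexive (solve 1 (λ m → (con 1 :+ m) :* con 1 := (con 1 :+ m :+ con 0) :+ con 0) refl M)
    where open +-*-Solver
  bernoulli M (suc n) = begin
    N * N ^ suc n                                   ≤⟨ ℕ.*-monoʳ-≤ N (bernoulli M n) ⟩
    N * (M ^ n * N + n * N ^ n)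
      ≡⟨ solve 4 (λ m x n y → (con 1 :+ m) :* (x :* (con 1 :+ m) :+ n :* y)
            := m :* x :* (con 1 :+ m) :+ (x :* (con 1 :+ m) :+ n :* ((con 1 :+ m) :* y))) refl M (M ^ n) n (N ^ n) ⟩
    M ^ suc n * N + (M ^ n * N + n * N ^ suc n)
      ≤⟨ ℕ.+-monoʳ-≤ (M ^ suc n * N) (ℕ.+-monoˡ-≤ (n * N ^ suc n) small) ⟩
    M ^ suc n * N + (N ^ suc n + n * N ^ suc n)     ∎
    where
    open ℕ.≤-Reasoning
    open +-*-Solver
    N = suc M
    small : M ^ n * N ≤ N ^ suc n
    small = ℕ.≤-trans (ℕ.*-monoˡ-≤ N (ℕ.^-monoˡ-≤ n (ℕ.n≤1+n M))) (ℕ.≤-reflexive (ℕ.*-comm (N ^ n) N))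

  -- Bernoulli's inequality with `n / N ≤ 1/2`. When `M` is the number of rows, `N` is `2 * 2 ^ k`
  -- and the condition becomes `n ≤ 2 ^ k`.
  suc^≤2*^ : ∀ M n → 2 * n ≤ suc M → suc M ^ n ≤ 2 * M ^ n
  suc^≤2*^ M n 2n≤N = ℕ.*-cancelˡ-≤ N (ℕ.+-cancelʳ-≤ (N * N ^ n) _ _ (begin
    N * N ^ n + N * N ^ n             ≡⟨ solve 1 (λ x → x :+ x := con 2 :* x) refl (N * N ^ n) ⟩
    2 * N ^ suc n                     ≤⟨ ℕ.*-monoʳ-≤ 2 (bernoulli M n) ⟩
    2 * (M ^ n * N + n * N ^ n)
      ≡⟨ solve 4 (λ x m n y → con 2 :* (x :* m :+ n :* y) := m :* (con 2 :* x) :+ (con 2 :* n) :* y) refl (M ^ n) N n (N ^ n) ⟩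
    N * (2 * M ^ n) + (2 * n) * N ^ n ≤⟨ ℕ.+-monoʳ-≤ (N * (2 * M ^ n)) (ℕ.*-monoˡ-≤ (N ^ n) 2n≤N) ⟩
    N * (2 * M ^ n) + N * N ^ n       ∎))
    where
    open ℕ.≤-Reasoning
    open +-*-Solver
    N = suc M

  ^-distribʳ-* : ∀ k m n → (m * n) ^ k ≡ m ^ k * n ^ k
  ^-distribʳ-* zero    m n = refl
  ^-distribʳ-* (suc k) m n = trans (cong (m * n *_) (^-distribʳ-* k m n))
    (solve 4 (λ m n x y → m :* n :* (x :* y) := (m :* x) :* (n :* y)) refl m n (m ^ k) (n ^ k))
    where open +-*-Solver

  n≤2^1+⌊log₂n⌋ : ∀ n → n ≤ 2 ^ suc ⌊log₂ n ⌋
  n≤2^1+⌊log₂n⌋ n with ℕ.≤-total n (2 ^ suc ⌊log₂ n ⌋)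
  ... | inj₁ n≤ = n≤
  ... | inj₂ n≥ = ⊥-elim (ℕ.1+n≰n (subst (_≤ ⌊log₂ n ⌋) (⌊log₂[2^n]⌋≡n (suc ⌊log₂ n ⌋)) (⌊log₂⌋-mono-≤ n≥)))

  -- The decoder

  module _ {a ℓ : Level} (G : AbelianGroup a ℓ) where
    open AbelianGroup G renaming (refl to ≈-refl; sym to ≈-sym; trans to ≈-trans; setoid to ≈-setoid)
    open import Relation.Binary.Reasoning.Setoid ≈-setoid

    private
      interch : ∀ w x y z → (w ∙ x) ∙ (y ∙ z) ≈ (w ∙ y) ∙ (x ∙ z)
      interch = interchange commutativeSemigroup

    -- Σ 2^i (uᵢ - vᵢ), for the interleaved vector of the uᵢ and vᵢ.
    weigh : ∀ k → Vec Carrier (k * 2) → Carrier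
    weigh zero    []          = ε
    weigh (suc k) (u ∷ v ∷ r) = (u - v) ∙ (weigh k r ∙ weigh k r)

    decode : ∀ k → Vec Carrier (suc (k * 2)) → Carrier
    decode k (w ∷ r) = w ∙ weigh k r

    -‿cong : ∀ {w x y z} → w ≈ x → y ≈ z → w - y ≈ x - z
    -‿cong p q = ∙-cong p (⁻¹-cong q)

    weigh-cong : ∀ {b} {A : Set b} k {f g : A → Carrier} {X : Vec A (k * 2)} →
      Vecᴬ.All (λ x → f x ≈ g x) X → weigh k (Vec.map f X) ≈ weigh k (Vec.map g X)
    weigh-cong zero    {X = []}        []           = ≈-refl
    weigh-cong (suc k) {X = _ ∷ _ ∷ _} (p ∷ q ∷ ps) =
      ∙-cong (-‿cong p q) (∙-cong (weigh-cong k ps) (weigh-cong k ps))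

    decode-cong : ∀ {b} {A : Set b} k {f g : A → Carrier} {X : Vec A (suc (k * 2))} →
      Vecᴬ.All (λ x → f x ≈ g x) X → decode k (Vec.map f X) ≈ decode k (Vec.map g X)
    decode-cong k {X = _ ∷ _} (p ∷ ps) = ∙-cong p (weigh-cong k ps)

    module _ {b c d} {A : Set b} {B : Set c} {C : Set d} {_⋆_ : A → B → C}
             {f : C → Carrier} {g : A → Carrier} {h : B → Carrier} (f-⋆ : ∀ x y → f (x ⋆ y) ≈ g x ∙ h y) where

      -- An integer combination is additive because `G` is commutative. The maps `f`, `g`, `h`
      -- differ because `_⋆_` will be `_∷_`, where an affine function splits into the term of its
      -- first bit and the rest.
      weigh-zipWith : ∀ k (X : Vec A (k * 2)) (Y : Vec B (k * 2)) →
        weigh k (Vec.map f (Vec.zipWith _⋆_ X Y)) ≈ weigh k (Vec.map g X) ∙ weigh k (Vec.map h Y)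
      weigh-zipWith zero [] [] = ≈-sym (identityˡ ε)
      weigh-zipWith (suc k) (x ∷ x′ ∷ X) (y ∷ y′ ∷ Y) = begin
        (f (x ⋆ y) - f (x′ ⋆ y′)) ∙ (w ∙ w)
          ≈⟨ ∙-cong (-‿cong (f-⋆ x y) (f-⋆ x′ y′)) (∙-cong (weigh-zipWith k X Y) (weigh-zipWith k X Y)) ⟩
        ((g x ∙ h y) - (g x′ ∙ h y′)) ∙ ((p ∙ q) ∙ (p ∙ q))
          ≈⟨ ∙-cong (∙-congˡ (≈-sym (⁻¹-∙-comm G (g x′) (h y′)))) (interch p q p q) ⟩
        ((g x ∙ h y) ∙ (g x′ ⁻¹ ∙ h y′ ⁻¹)) ∙ ((p ∙ p) ∙ (q ∙ q))
          ≈⟨ ∙-congʳ (interch (g x) (h y) (g x′ ⁻¹) (h y′ ⁻¹)) ⟩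
        ((g x - g x′) ∙ (h y - h y′)) ∙ ((p ∙ p) ∙ (q ∙ q))
          ≈⟨ interch (g x - g x′) (h y - h y′) (p ∙ p) (q ∙ q) ⟩
        ((g x - g x′) ∙ (p ∙ p)) ∙ ((h y - h y′) ∙ (q ∙ q)) ∎
        where
        w = weigh k (Vec.map f (Vec.zipWith _⋆_ X Y))
        p = weigh k (Vec.map g X)
        q = weigh k (Vec.map h Y)

      decode-zipWith : ∀ k (X : Vec A (suc (k * 2))) (Y : Vec B (suc (k * 2))) →
        decode k (Vec.map f (Vec.zipWith _⋆_ X Y)) ≈ decode k (Vec.map g X) ∙ decode k (Vec.map h Y)
      decode-zipWith k (x ∷ X) (y ∷ Y) =
        ≈-trans (∙-cong (f-⋆ x y) (weigh-zipWith k X Y)) (interch (g x) (h y) _ _)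

    weigh-twin : ∀ x {z} → z ≈ ε → (x - x) ∙ (z ∙ z) ≈ ε
    weigh-twin x {z} z≈ε = begin
      (x - x) ∙ (z ∙ z)   ≈⟨ ∙-cong (inverseʳ x) (∙-cong z≈ε z≈ε) ⟩
      ε ∙ (ε ∙ ε)         ≈⟨ identityˡ (ε ∙ ε) ⟩
      ε ∙ ε               ≈⟨ identityˡ ε ⟩
      ε                   ∎

    weigh-replicate : ∀ {b} {A : Set b} k (f : A → Carrier) (x : A) → weigh k (Vec.map f (Vec.replicate (k * 2) x)) ≈ ε
    weigh-replicate zero    f x = ≈-refl
    weigh-replicate (suc k) f x = weigh-twin (f x) (weigh-replicate k f x)

    decode-replicate : ∀ {b} {A : Set b} k (f : A → Carrier) (x : A) →
      decode k (Vec.map f (Vec.replicate (suc (k * 2)) x)) ≈ f x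
    decode-replicate k f x = ≈-trans (∙-congˡ (weigh-replicate k f x)) (identityʳ (f x))

    weigh-twins : ∀ k → All (λ y → ∀ (β : Bool → Carrier) → weigh k (Vec.map β y) ≈ ε) (twins k)
    weigh-twins zero    = (λ β → ≈-refl) ∷ []
    weigh-twins (suc k) = All.++⁺ (All.map⁺ (All.map step (weigh-twins k))) (All.map⁺ (All.map step (weigh-twins k)))
      where
      step : ∀ {b y} → (∀ β → weigh k (Vec.map β y) ≈ ε) → ∀ β → weigh (suc k) (Vec.map β (b ∷ b ∷ y)) ≈ ε
      step {b} z β = weigh-twin (β b) (z β)

    -- Any `β` on bits is affine with slope `β true - β false`, and `u - v = -1` scales this slope.
    -- The induction follows the carry: the lowest pair `1, 0` contributes 1, and twice the
    -- inductive value -1 brings the total back to -1.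
    weigh-succs : ∀ k → All (λ y → ∀ (β : Bool → Carrier) → weigh k (Vec.map β y) ≈ β false - β true) (succs k)
    weigh-succs zero    = []
    weigh-succs (suc k) = All.++⁺ (All.map⁺ (All.map noCarry (weigh-twins k))) (All.map⁺ (All.map carry (weigh-succs k)))
      where
      noCarry : ∀ {y} → (∀ β → weigh k (Vec.map β y) ≈ ε) →
        ∀ β → weigh (suc k) (Vec.map β (false ∷ true ∷ y)) ≈ β false - β true
      noCarry z β = ≈-trans (∙-congˡ (≈-trans (∙-cong (z β) (z β)) (identityˡ ε))) (identityʳ _)

      carry : ∀ {y} → (∀ β → weigh k (Vec.map β y) ≈ β false - β true) →
        ∀ β → weigh (suc k) (Vec.map β (true ∷ false ∷ y)) ≈ β false - β true
      carry {y} z β = begin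
        (t - f) ∙ (weigh k (Vec.map β y) ∙ weigh k (Vec.map β y))   ≈⟨ ∙-congˡ (∙-cong (z β) (z β)) ⟩
        (t - f) ∙ ((f - t) ∙ (f - t))   ≈⟨ assoc (t - f) (f - t) (f - t) ⟨
        ((t - f) ∙ (f - t)) ∙ (f - t)   ≈⟨ ∙-congʳ (∙-congˡ (comm f (t ⁻¹))) ⟩
        ((t - f) ∙ (t ⁻¹ ∙ f)) ∙ (f - t) ≈⟨ ∙-congʳ (interch t (f ⁻¹) (t ⁻¹) f) ⟩
        ((t - t) ∙ (f ⁻¹ ∙ f)) ∙ (f - t) ≈⟨ ∙-congʳ (∙-cong (inverseʳ t) (inverseˡ f)) ⟩
        (ε ∙ ε) ∙ (f - t)               ≈⟨ ∙-congʳ (identityˡ ε) ⟩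
        ε ∙ (f - t)                     ≈⟨ identityˡ (f - t) ⟩
        f - t                           ∎
        where
        t = β true
        f = β false

    -- This says w + Σ 2^i (uᵢ - vᵢ) = 0 for the row (w, u, v): every β is affine in the bit,
    -- and the weights of the decoder add up to 1.
    Centred : ∀ k → Vec Bool (suc (k * 2)) → Set _
    Centred k y = ∀ (β : Bool → Carrier) → decode k (Vec.map β y) ≈ β false

    rows-centred : ∀ k → All (Centred k) (rows k)
    rows-centred k = All.++⁺ (All.map⁺ (All.map twin (weigh-twins k))) (All.map⁺ (All.map succ (weigh-succs k)))
      where
      twin : ∀ {y} → (∀ β → weigh k (Vec.map β y) ≈ ε) → Centred k (false ∷ y)
      twin z β = ≈-trans (∙-congˡ (z β)) (identityʳ _)
      succ : ∀ {y} → (∀ β → weigh k (Vec.map β y) ≈ β false - β true) → Centred k (true ∷ y)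
      succ {y} z β = begin
        β true ∙ weigh k (Vec.map β y)   ≈⟨ ∙-congˡ (z β) ⟩
        β true ∙ (β false - β true)      ≈⟨ assoc _ _ _ ⟨
        (β true ∙ β false) - β true      ≈⟨ xyx⁻¹≈y G (β true) (β false) ⟩
        β false                          ∎

    -- One coordinate at a time: its contribution depends only on the bit of the shift, so it is a
    -- `β` to which `Centred` applies. The value `β false` belongs to the unshifted point, since
    -- `false xor b` is `b`. With no coordinates left, the constant term survives because the
    -- weights add up to 1.
    decode-affine : ∀ k {n} (a₀ : Carrier) (as : Vec Carrier n) (x : Cube n) {M : Vec (Vec Bool (suc (k * 2))) n} →
      Vecᴬ.All (Centred k) M →
      decode k (Vec.map (λ z → affine G a₀ as (z ⊕ x)) (columns M)) ≈ affine G a₀ as x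
    decode-affine k a₀ [] [] [] = decode-replicate k (λ z → affine G a₀ [] (z ⊕ [])) []
    decode-affine k a₀ (c ∷ cs) (b ∷ x) {y ∷ M} (y-centred ∷ M-centred) = begin
      decode k (Vec.map (λ z → affine G a₀ (c ∷ cs) (z ⊕ (b ∷ x))) (Vec.zipWith _∷_ y (columns M)))
        ≈⟨ decode-zipWith (λ b′ z → x∙yz≈y∙xz commutativeSemigroup a₀ (bitScale G (b′ xor b) c) (linSum G cs (z ⊕ x)))
             k y (columns M) ⟩
      decode k (Vec.map (λ b′ → bitScale G (b′ xor b) c) y) ∙ decode k (Vec.map (λ z → affine G a₀ cs (z ⊕ x)) (columns M))
        ≈⟨ ∙-cong (y-centred _) (decode-affine k a₀ cs x M-centred) ⟩
      bitScale G b c ∙ affine G a₀ cs x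
        ≈⟨ x∙yz≈y∙xz commutativeSemigroup (bitScale G b c) a₀ (linSum G cs x) ⟩
      affine G a₀ (c ∷ cs) (b ∷ x) ∎

    -- The algorithm and its success probability

    askAll : ∀ {n q} → Vec (Cube n) q → (Vec Carrier q → Carrier) → QTree G n q
    askAll []      F = out (F [])
    askAll (x ∷ X) F = ask x (λ g → askAll X (F ∘ (g ∷_)))

    run-askAll : ∀ {n q} (X : Vec (Cube n) q) (F : Vec Carrier q → Carrier) f → run G (askAll X F) f ≡ F (Vec.map f X)
    run-askAll []      F f = refl
    run-askAll (x ∷ X) F f = run-askAll X (F ∘ (f x ∷_)) f

    -- The factor 8 in the hypothesis is `2 * 4`: a query hits a bad point at most twice as often as
    -- a uniform point would, and the union bound over all queries must not exceed 1/4.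
    corrector : ∀ k n (δ : ℚ.ℚ) →
      (∀ (xs : List (Cube n)) → Unique xs → (ℚ.1ℚ ℚ.- δ) ℚ.* ℕ→ℚ (2 ^ n) ℚ.≤ ℕ→ℚ (length xs) →
        8 * (suc (k * 2) * ∑ (cube n) (miss xs)) ≤ 2 ^ n) →
      n ≤ 2 ^ k → HasLocalCorrector G n δ (suc (k * 2))
    -- Generalising the seed list to `L` permits a match on it; the nonempty case provides the seed
    -- count in the form `suc`.
    corrector k n δ few n≤2^k = go (words (rows k) n) refl
      where
      q = suc (k * 2)
      M = length (rows k)

      [2*2^k]^n≤ : (2 * 2 ^ k) ^ n ≤ 2 * M ^ n
      [2*2^k]^n≤ = subst (λ N → N ^ n ≤ 2 * M ^ n) (length-rows k)
        (suc^≤2*^ M n (subst (2 * n ≤_) (sym (length-rows k)) (ℕ.*-monoʳ-≤ 2 n≤2^k)))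

      go : ∀ L → L ≡ words (rows k) n → HasLocalCorrector G n δ q
      -- An empty list would force `M ^ n = 0`, contradicting `[2*2^k]^n≤`, whose left side is
      -- positive.
      go [] eq = ⊥-elim (ℕ.<⇒≱ (ℕ.m^n>0 (2 * 2 ^ k) {{ℕ.m*n≢0 2 (2 ^ k) {{_}} {{ℕ.m^n≢0 2 k}}}} n)
                   (subst (λ T → (2 * 2 ^ k) ^ n ≤ 2 * T)
                     (trans (sym (length-words (rows k) n)) (cong length (sym eq))) [2*2^k]^n≤))
      go L@(s ∷ ss) eq = A , correct
        where
        A : Algorithm G n q
        A = record { seeds = length ss ; strategy = λ x r → askAll (queries x (List.lookup L r)) (decode k) }

        correct : ∀ f a₀ as → CloseTo G f (affine G a₀ as) δ → ∀ x → SucceedsWP34 G A f x (affine G a₀ as x)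
        correct f a₀ as (xs , uniq , agree , many) x = S , succeeds , enough
          where
          w : Vec (Vec Bool q) n → ℕ
          w M = load (miss xs) (queries x M)
          -- The seeds for which every query lies in `xs`, where `f` agrees with the affine
          -- function.
          S = proj₁ (zeroSet L w)

          succeeds : ∀ r → r ∈ S → run G (askAll (queries x (List.lookup L r)) (decode k)) f ≈ affine G a₀ as x
          succeeds r r∈S = begin
            run G (askAll Q (decode k)) f                                   ≡⟨ run-askAll Q (decode k) f ⟩
            decode k (Vec.map f Q)                                          ≈⟨ decode-cong k good ⟩
            decode k (Vec.map (affine G a₀ as) Q)
              ≡⟨ cong (decode k) (map-∘ᵛ (affine G a₀ as) (_⊕ x) (columns N)) ⟨
            decode k (Vec.map (λ z → affine G a₀ as (z ⊕ x)) (columns N))   ≈⟨ decode-affine k a₀ as x centred ⟩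
            affine G a₀ as x                                                ∎
            where
            N = List.lookup L r
            Q = queries x N
            good : Vecᴬ.All (λ z → f z ≈ affine G a₀ as z) Q
            good = Vecᴬ.map (λ {z} z≡0 → All.lookup agree (miss≡0⇒∈ xs z z≡0))
                     (load≡0⇒All (miss xs) Q (proj₁ (proj₂ (zeroSet L w)) r r∈S))
            centred : Vecᴬ.All (Centred k) N
            centred = All.lookup (subst (All _) (sym eq) (All-words (rows-centred k) n)) (∈-lookup r)

          |L|≡ : length L ≡ M ^ n
          |L|≡ = trans (cong length eq) (length-words (rows k) n)

          bad = ∑ (cube n) (miss xs)

          -- The goal is doubled to make room for the factor 2 of `[2*2^k]^n≤`, which compares
          -- `(2 * B) ^ n` with the number `M ^ n` of seeds.
          errors : 4 * ∑ L w ≤ length L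
          errors = ℕ.*-cancelˡ-≤ 2 (ℕR.begin
            2 * (4 * ∑ L w)                    ℕR.≤⟨ ℕ.*-monoʳ-≤ 2 (ℕ.*-monoʳ-≤ 4 total) ⟩
            2 * (4 * (q * (B ^ n * bad)))
              ℕR.≡⟨ solve 3 (λ q b m → con 2 :* (con 4 :* (q :* (b :* m))) := (con 8 :* (q :* m)) :* b) refl q (B ^ n) bad ⟩
            8 * (q * bad) * B ^ n              ℕR.≤⟨ ℕ.*-monoˡ-≤ (B ^ n) (few xs uniq many) ⟩
            2 ^ n * B ^ n                      ℕR.≡⟨ ^-distribʳ-* n 2 B ⟨
            (2 * B) ^ n                        ℕR.≤⟨ [2*2^k]^n≤ ⟩
            2 * M ^ n                          ℕR.≡⟨ cong (2 *_) |L|≡ ⟨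
            2 * length L                       ℕR.∎)
            where
            open +-*-Solver
            module ℕR = ℕ.≤-Reasoning
            B = 2 ^ k
            total : ∑ L w ≤ q * (B ^ n * bad)
            total = subst (λ L → ∑ L w ≤ q * (B ^ n * bad)) (sym eq)
              (∑-load-queries≤ {B = B} (rows-spread k) x (miss xs))

          enough : 3 * length L ≤ 4 * ∣ S ∣
          enough = ℕ.+-cancelʳ-≤ (length L) _ _ (ℕR.begin
            3 * length L + length L     ℕR.≡⟨ solve 1 (λ l → con 3 :* l :+ l := con 4 :* l) refl (length L) ⟩
            4 * length L                ℕR.≤⟨ ℕ.*-monoʳ-≤ 4 (proj₂ (proj₂ (zeroSet L w))) ⟩
            4 * (∣ S ∣ + ∑ L w)         ℕR.≡⟨ ℕ.*-distribˡ-+ 4 ∣ S ∣ (∑ L w) ⟩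
            4 * ∣ S ∣ + 4 * ∑ L w       ℕR.≤⟨ ℕ.+-monoʳ-≤ (4 * ∣ S ∣) errors ⟩
            4 * ∣ S ∣ + length L        ℕR.∎)
            where
            open +-*-Solver
            module ℕR = ℕ.≤-Reasoning

  -- Rational arithmetic and the choice of constants

  -- `ℕ→ℚ k` is normalised through a gcd and does not reduce for a variable `k`; unnormalised
  -- fractions reduce the facts below to integer arithmetic.
  ℕ→ℚᵘ : ∀ k → ℚ.toℚᵘ (ℕ→ℚ k) ℚᵘ.≃ ℚᵘ.mkℚᵘ (+ k) 0
  ℕ→ℚᵘ k = ℚ.toℚᵘ-fromℚᵘ (ℚᵘ.mkℚᵘ (+ k) 0)

  ℕ→ℚ-+ : ∀ m n → ℕ→ℚ (m + n) ≡ ℕ→ℚ m ℚ.+ ℕ→ℚ n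
  ℕ→ℚ-+ m n = ℚ.toℚᵘ-injective (begin
    ℚ.toℚᵘ (ℕ→ℚ (m + n))                        ≈⟨ ℕ→ℚᵘ (m + n) ⟩
    ℚᵘ.mkℚᵘ (+ (m + n)) 0
      ≈⟨ ℚᵘ.*≡* (cong (ℤ._* + 1) (cong₂ ℤ._+_ (sym (ℤ.*-identityʳ (+ m))) (sym (ℤ.*-identityʳ (+ n))))) ⟩
    ℚᵘ.mkℚᵘ (+ m) 0 ℚᵘ.+ ℚᵘ.mkℚᵘ (+ n) 0        ≈⟨ ℚᵘ.+-cong (ℕ→ℚᵘ m) (ℕ→ℚᵘ n) ⟨
    ℚ.toℚᵘ (ℕ→ℚ m) ℚᵘ.+ ℚ.toℚᵘ (ℕ→ℚ n)          ≈⟨ ℚ.toℚᵘ-homo-+ (ℕ→ℚ m) (ℕ→ℚ n) ⟨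
    ℚ.toℚᵘ (ℕ→ℚ m ℚ.+ ℕ→ℚ n)                    ∎)
    where open ℚᵘ.≃-Reasoning

  ℕ→ℚ-* : ∀ m n → ℕ→ℚ (m * n) ≡ ℕ→ℚ m ℚ.* ℕ→ℚ n
  ℕ→ℚ-* m n = ℚ.toℚᵘ-injective (begin
    ℚ.toℚᵘ (ℕ→ℚ (m * n))                        ≈⟨ ℕ→ℚᵘ (m * n) ⟩
    ℚᵘ.mkℚᵘ (+ (m * n)) 0                       ≈⟨ ℚᵘ.*≡* (cong (ℤ._* + 1) (ℤ.pos-* m n)) ⟩
    ℚᵘ.mkℚᵘ (+ m) 0 ℚᵘ.* ℚᵘ.mkℚᵘ (+ n) 0        ≈⟨ ℚᵘ.*-cong (ℕ→ℚᵘ m) (ℕ→ℚᵘ n) ⟨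
    ℚ.toℚᵘ (ℕ→ℚ m) ℚᵘ.* ℚ.toℚᵘ (ℕ→ℚ n)          ≈⟨ ℚ.toℚᵘ-homo-* (ℕ→ℚ m) (ℕ→ℚ n) ⟨
    ℚ.toℚᵘ (ℕ→ℚ m ℚ.* ℕ→ℚ n)                    ∎)
    where open ℚᵘ.≃-Reasoning

  ℕ→ℚ-mono-≤ : ∀ {m n} → m ≤ n → ℕ→ℚ m ℚ.≤ ℕ→ℚ n
  ℕ→ℚ-mono-≤ {m} {n} m≤n = ℚ.toℚᵘ-cancel-≤ (begin
    ℚ.toℚᵘ (ℕ→ℚ m)     ≃⟨ ℕ→ℚᵘ m ⟩
    ℚᵘ.mkℚᵘ (+ m) 0    ≤⟨ ℚᵘ.*≤* (ℤ.*-monoʳ-≤-nonNeg (+ 1) (ℤ.+≤+ m≤n)) ⟩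
    ℚᵘ.mkℚᵘ (+ n) 0    ≃⟨ ℕ→ℚᵘ n ⟨
    ℚ.toℚᵘ (ℕ→ℚ n)     ∎)
    where open ℚᵘ.≤-Reasoning

  ℕ→ℚ-cancel-≤ : ∀ {m n} → ℕ→ℚ m ℚ.≤ ℕ→ℚ n → m ≤ n
  ℕ→ℚ-cancel-≤ {m} {n} m≤n = ℤ.drop‿+≤+ (ℤ.*-cancelʳ-≤-pos (+ m) (+ n) (+ 1) (ℚᵘ.drop-*≤* (begin
    ℚᵘ.mkℚᵘ (+ m) 0    ≃⟨ ℕ→ℚᵘ m ⟨
    ℚ.toℚᵘ (ℕ→ℚ m)     ≤⟨ ℚ.toℚᵘ-mono-≤ m≤n ⟩
    ℚ.toℚᵘ (ℕ→ℚ n)     ≃⟨ ℕ→ℚᵘ n ⟩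
    ℚᵘ.mkℚᵘ (+ n) 0    ∎)))
    where open ℚᵘ.≤-Reasoning

  ℕ→ℚ-nonNeg : ∀ n → ℚ.NonNegative (ℕ→ℚ n)
  ℕ→ℚ-nonNeg n = ℚ.nonNegative (ℕ→ℚ-mono-≤ {0} {n} z≤n)

  -- At least `(1 - δ) N` of the `N` points are listed, so at most `δ N` are bad; multiplying by
  -- `40 l` and using `δ l < 1/40` leaves at most `N`.
  fewErrors : ∀ (δ : ℚ.ℚ) (l b y N : ℕ) → δ ℚ.* ℕ→ℚ l ℚ.< + 1 ℚ./ 40 →
    (ℚ.1ℚ ℚ.- δ) ℚ.* ℕ→ℚ N ℚ.≤ ℕ→ℚ y → b + y ≤ N → 40 * (l * b) ≤ N
  fewErrors δ l b y N δl<c close b+y≤N = ℕ→ℚ-cancel-≤ (begin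
    ℕ→ℚ (40 * (l * b))                     ≡⟨ trans (ℕ→ℚ-* 40 (l * b)) (cong (ℕ→ℚ 40 ℚ.*_) (ℕ→ℚ-* l b)) ⟩
    ℕ→ℚ 40 ℚ.* (ℕ→ℚ l ℚ.* ℕ→ℚ b)           ≤⟨ ℚ.*-monoˡ-≤-nonNeg (ℕ→ℚ 40) (ℚ.*-monoˡ-≤-nonNeg (ℕ→ℚ l) {{ℕ→ℚ-nonNeg l}} b≤δN) ⟩
    ℕ→ℚ 40 ℚ.* (ℕ→ℚ l ℚ.* (δ ℚ.* ℕ→ℚ N))
      ≡⟨ cong (ℕ→ℚ 40 ℚ.*_) (solve 3 (λ l d n → l :* (d :* n) := (d :* l) :* n) refl (ℕ→ℚ l) δ (ℕ→ℚ N)) ⟩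
    ℕ→ℚ 40 ℚ.* ((δ ℚ.* ℕ→ℚ l) ℚ.* ℕ→ℚ N)
      ≤⟨ ℚ.*-monoˡ-≤-nonNeg (ℕ→ℚ 40) (ℚ.*-monoʳ-≤-nonNeg (ℕ→ℚ N) {{ℕ→ℚ-nonNeg N}} (ℚ.<⇒≤ δl<c)) ⟩
    ℕ→ℚ 40 ℚ.* ((+ 1 ℚ./ 40) ℚ.* ℕ→ℚ N)    ≡⟨ ℚ.*-assoc (ℕ→ℚ 40) (+ 1 ℚ./ 40) (ℕ→ℚ N) ⟨
    -- The product of the closed rationals 40 and 1/40 evaluates to `1ℚ`.
    ℚ.1ℚ ℚ.* ℕ→ℚ N                         ≡⟨ ℚ.*-identityˡ (ℕ→ℚ N) ⟩
    ℕ→ℚ N                                  ∎)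
    where
    open ℚ.≤-Reasoning
    open ℚ-Solver
    b≤δN : ℕ→ℚ b ℚ.≤ δ ℚ.* ℕ→ℚ N
    b≤δN = begin
      ℕ→ℚ b                                               ≡⟨ solve 2 (λ b y → b := (b :+ y) :- y) refl (ℕ→ℚ b) (ℕ→ℚ y) ⟩
      (ℕ→ℚ b ℚ.+ ℕ→ℚ y) ℚ.- ℕ→ℚ y                         ≡⟨ cong (ℚ._- ℕ→ℚ y) (ℕ→ℚ-+ b y) ⟨
      ℕ→ℚ (b + y) ℚ.- ℕ→ℚ y                               ≤⟨ ℚ.+-mono-≤ (ℕ→ℚ-mono-≤ b+y≤N) (ℚ.neg-antimono-≤ close) ⟩
      ℕ→ℚ N ℚ.- (ℚ.1ℚ ℚ.- δ) ℚ.* ℕ→ℚ N                    ≡⟨ solve 2 (λ d n → n :- (con ℚ.1ℚ :- d) :* n := d :* n) refl δ (ℕ→ℚ N) ⟩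
      δ ℚ.* ℕ→ℚ N                                         ∎

  -- With `k = 1 + l` the number of queries is `2 k + 1 = 3 + 2 l`, which is at most `5 l` once
  -- `l ≥ 1`; this is where `2 ≤ n` enters.
  correctorLog : ∀ {a ℓ} (G : AbelianGroup a ℓ) n → 2 ≤ n → (δ : ℚ.ℚ) → δ ℚ.* logℚ n ℚ.< + 1 ℚ./ 40 →
    Σ ℕ λ q → (ℕ→ℚ q ℚ.≤ ℕ→ℚ 5 ℚ.* logℚ n) × HasLocalCorrector G n δ q
  correctorLog G n 2≤n δ δl<c = q ,
    subst (ℕ→ℚ q ℚ.≤_) (ℕ→ℚ-* 5 l) (ℕ→ℚ-mono-≤ q≤5l) ,
    corrector G (suc l) n δ few (n≤2^1+⌊log₂n⌋ n)
    where
    open ℕ.≤-Reasoning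
    open +-*-Solver
    l = ⌊log₂ n ⌋
    q = suc (suc l * 2)

    q≤5l : q ≤ 5 * l
    q≤5l = begin
      3 + l * 2        ≤⟨ ℕ.+-monoˡ-≤ (l * 2) (ℕ.*-monoʳ-≤ 3 (⌊log₂⌋-mono-≤ 2≤n)) ⟩
      3 * l + l * 2    ≡⟨ solve 1 (λ l → con 3 :* l :+ l :* con 2 := con 5 :* l) refl l ⟩
      5 * l            ∎

    few : ∀ xs → Unique xs → (ℚ.1ℚ ℚ.- δ) ℚ.* ℕ→ℚ (2 ^ n) ℚ.≤ ℕ→ℚ (length xs) →
      8 * (q * ∑ (cube n) (miss xs)) ≤ 2 ^ n
    few xs uniq close = begin
      8 * (q * b)          ≤⟨ ℕ.*-monoʳ-≤ 8 (ℕ.*-monoˡ-≤ b q≤5l) ⟩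
      8 * (5 * l * b)      ≡⟨ solve 2 (λ l b → con 8 :* (con 5 :* l :* b) := con 40 :* (l :* b)) refl l b ⟩
      40 * (l * b)         ≤⟨ fewErrors δ l b (length xs) (2 ^ n) δl<c close (∑-miss uniq) ⟩
      2 ^ n                ∎
      where b = ∑ (cube n) (miss xs)

open import Data.Rational using (ℚ; 0ℚ; _*_; _<_; _≤_)

theorem3p1 : ∀ {a ℓ : Level} →
    Σ ℚ λ c → Σ ℚ λ C → (0ℚ < c) × (0ℚ < C) ×
    ((G : AbelianGroup a ℓ) (n : ℕ) → 2 ℕ.≤ n →
    (δ : ℚ) → δ * logℚ n < c →
    Σ ℕ λ q → (ℕ→ℚ q ≤ C * logℚ n) × HasLocalCorrector G n δ q)
-- Here `40 = 8 * 5`, with 8 from the hypothesis of `corrector` and 5 from `q ≤ 5 * l`, which also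
-- gives `C`.
theorem3p1 = + 1 ℚ./ 40 , ℕ→ℚ 5 , ℚ.positive⁻¹ _ , ℚ.positive⁻¹ _ , correctorLog
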